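{- Let $\alpha\ge 1$ and suppose we are given an $\alpha$-approximation algorithm for Parallel Densest Subfamily (PDS). Then the greedy algorithm GREEDY (described in the context), which repeatedly calls this PDS algorithm, is a $4\alpha$-approximation algorithm for Parallel Min-Sum Set Cover (PMSSC): for every instance of PMSSC it returns a feasible schedule $\pi$ with $$\operatorname{cost}(\pi)\le 4\alpha\cdot \operatorname{cost}(\sigma),$$ where $\sigma$ is a feasible schedule of minimum cost.
   Context: Notation: $\mathbb{N}=\{1,2,\dots\}$ and $[m]=\{1,\dots,m\}$. PMSSC instance: a finite universe $\mathcal{U}$ of $n$ elements, a collection $\mathcal{S}$ of $k$ subsets of $\mathcal{U}$ with $\bigcup_{S\in\mathcal{S}}S=\mathcal{U}$, a number $m\ge1$ of machines, a cost function $c:\mathcal{S}\times[m]\to\mathbb{N}$ (arbitrary, i.e. unrelated machines), and weights $w:\mathcal{U}\to\mathbb{N}$. For $\mathcal{U}'\subseteq\mathcal{U}$, $w(\mathcal{U}')=\sum_{u\in\mathcal{U}'}w(u)$. A schedule $\sigma=\{\sigma(j)\}_{j=1}^m$ consists of $m$ sequences of sets from $\mathcal{S}$, where each set is scheduled at most once overall. It is feasible if the sets occurring in it cover $\mathcal{U}$. If $S$ is scheduled on machine $j_S$, its finish time $\operatorname{ft}(S)$ is the sum of $c(S',j_S)$ over all sets $S'$ in the prefix of $\sigma(j_S)$ ending with (and including) $S$. The covering time of $u\in\mathcal{U}$ is $\operatorname{ct}(u)=\min\{\operatorname{ft}(S): S\ni u,\ S\text{ scheduled in }\sigma\}$. The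 cost is $\operatorname{cost}(\sigma)=\sum_{u\in\mathcal{U}}w(u)\operatorname{ct}(u)$, to be minimized. Assignments and density: an assignment $\mathcal{F}=\{\mathcal{F}(j)\}_{j=1}^m$ of sets from $\mathcal{S}'\subseteq\mathcal{S}$ assigns some of the sets of $\mathcal{S}'$ to machines (each to at most one machine; at least one set is assigned). Its length is $|\mathcal{F}|=\max_{j\in[m]}\sum_{S\in\mathcal{F}(j)}c(S,j)$. For $R\subseteq\mathcal{U}$, $\operatorname{cov}(\mathcal{F},R)=\bigcup_{j}\bigcup_{S\in\mathcal{F}(j)}(S\cap R)$, and the density is $\Delta(\mathcal{F},R)=w(\operatorname{cov}(\mathcal{F},R))/|\mathcal{F}|$. PDS with input $(R,\mathcal{S}')$: find an assignment $\mathcal{F}$ of sets from $\mathcal{S}'$ maximizing $\Delta(\mathcal{F},R)$. An $\alpha$-approximation algorithm for PDS returns an assignment whose density is at least $1/\alpha$ times the maximum. Algorithm GREEDY: start with the empty schedule $\pi$, $R=\mathcal{U}$, $\mathcal{S}'=\mathcal{S}$. While $R\ne\emptyset$: run the $\alpha$-approximation algorithm for PDS on input $(R,\mathcal{S}')$ to obtain an assignment $\mathcal{F}$; for each $j\in[m]$, append the sets of $\mathcal{F}(j)$ (in any order) to the end of $\pi(j)$ and remove them from $\mathcal{S}'$; then replace $R$ by $R\setminus\operatorname{cov}(\mathcal{F},R)$. Return $\pi$. -}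

module Defs where

open import Data.Fin using (Fin; _≟_)
open import Data.Fin.Subset
  using (Subset; _∈_; _⊆_; _∩_; _─_; ⊤; ⋃; Nonempty; Empty)
open import Data.Fin.Subset.Properties using (_∈?_)
open import Data.Integer using (+_)
open import Data.List using (List; []; _∷_; _++_; map; concatMap; filter; foldr; allFin)
open import Data.List.Extrema.Nat using (max; xs≤max)
import Data.List.Membership.Propositional as List
open import Data.List.Membership.Propositional.Properties
  using (∈-allFin; ∈-filter⁺; ∈-map⁺)
open import Data.List.Relation.Binary.Permutation.Propositional using (_↭_)
open import Data.List.Relation.Unary.All using (lookup)
open import Data.List.Relation.Unary.Any using (here; there)
open import Data.List.Relation.Unary.Unique.Propositional using (Unique)
open import Data.Nat using (ℕ; NonZero; >-nonZero; _+_; _*_; _⊓_; _<_; _≤_)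
open import Data.Nat.ListAction using (sum)
open import Data.Nat.Properties using (≤-trans; <-≤-trans; m≤m+n; m≤n+m)
open import Data.Product using (∃; ∃-syntax; _×_; _,_)
open import Data.Rational as ℚ using (ℚ; _/_)
open import Data.Sum using (_⊎_)
open import Function.Bundles using (_⇔_)
open import Relation.Binary.Construct.Closure.ReflexiveTransitive using (Star)
open import Relation.Binary.PropositionalEquality using (_≡_; refl)
open import Relation.Nullary using (¬_; yes; no)

-- Real numbers as two-sided Dedekind cuts: `lower q` reads q < α and
-- `upper q` reads α < q.
record ℝ : Set₁ where
  field
    lower upper     : ℚ → Set
    lower-inhabited : ∃ lower
    upper-inhabited : ∃ upper
    lower-rounded   : ∀ q → lower q ⇔ (∃[ r ] q ℚ.< r × lower r)
    upper-rounded   : ∀ q → upper q ⇔ (∃[ r ] r ℚ.< q × upper r)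
    disjoint        : ∀ q → ¬ (lower q × upper q)
    located         : ∀ {q r} → q ℚ.< r → lower q ⊎ upper r

infix 4 _≤ᴿ_ _≤_·_

_≤ᴿ_ : ℚ → ℝ → Set
q ≤ᴿ α = ¬ ℝ.upper α q

-- `x ≤ α · y` is the real inequality x ≤ αy.  It is used only for y ≥ 0, where
-- αy is the infimum of qy over the rationals q > α.
_≤_·_ : ℚ → ℝ → ℚ → Set
x ≤ α · y = ∀ q → ℝ.upper α q → x ℚ.≤ q ℚ.* y

fromℕ : ℕ → ℚ
fromℕ x = + x / 1

elements : ∀ {n} → Subset n → List (Fin n)
elements p = filter (_∈? p) (allFin _)

-- The value on the empty list is never used below for a feasible schedule.
minimum : List ℕ → ℕ
minimum []       = 0
minimum (x ∷ xs) = foldr _⊓_ x xs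

-- The collection is indexed by Fin k, so "a set of the collection" means an
-- index; two indices may carry the same subset, possibly at different costs.
record Instance : Set where
  field
    n k m      : ℕ
    {{m≥1}}    : NonZero m
    𝒮          : Fin k → Subset n
    𝒮-covers   : ∀ u → ∃[ S ] u ∈ 𝒮 S
    c          : Fin k → Fin m → ℕ
    c-positive : ∀ S j → 0 < c S j
    w          : Fin n → ℕ
    w-positive : ∀ u → 0 < w u

module Scheduling (I : Instance) where
  open Instance I

  weight : Subset n → ℕ
  weight U = sum (map w (elements U))

  Sequences : Set
  Sequences = Fin m → List (Fin k)

  record IsSchedule (σ : Sequences) : Set where
    field
      once-per-machine : ∀ j → Unique (σ j)
      one-machine      : ∀ {i j S} → S List.∈ σ i → S List.∈ σ j → i ≡ j

  Covers : Sequences → Set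
  Covers σ = ∀ u → ∃[ j ] ∃[ S ] S List.∈ σ j × u ∈ 𝒮 S

  Feasible : Sequences → Set
  Feasible σ = IsSchedule σ × Covers σ

  -- The prefix of a sequence ending with, and including, S.
  prefix : Fin k → List (Fin k) → List (Fin k)
  prefix S []      = []
  prefix S (T ∷ l) with S ≟ T
  ... | yes _ = T ∷ []
  ... | no  _ = T ∷ prefix S l

  ft : Sequences → Fin m → Fin k → ℕ
  ft σ j S = sum (map (λ T → c T j) (prefix S (σ j)))

  ct : Sequences → Fin n → ℕ
  ct σ u = minimum
    (concatMap (λ j → map (ft σ j) (filter (λ S → u ∈? 𝒮 S) (σ j))) (allFin m))

  cost : Sequences → ℕ
  cost σ = sum (map (λ u → w u * ct σ u) (allFin n))

  Optimal : Sequences → Set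
  Optimal σ = Feasible σ × (∀ τ → Feasible τ → cost σ ≤ cost τ)

  record Assignment (S′ : Subset k) : Set where
    field
      on          : Fin m → Subset k
      available   : ∀ j → on j ⊆ S′
      one-machine : ∀ {i j S} → S ∈ on i → S ∈ on j → i ≡ j
      nonempty    : ∃[ j ] Nonempty (on j)

    load : Fin m → ℕ
    load j = sum (map (λ S → c S j) (elements (on j)))

    length : ℕ
    length = max 0 (map load (allFin m))

    assigned : Subset k
    assigned = ⋃ (map on (allFin m))

    cov : Subset n → Subset n
    cov R = ⋃ (concatMap (λ j → map (λ S → 𝒮 S ∩ R) (elements (on j))) (allFin m))

    length-positive : 0 < length
    length-positive with nonempty
    ... | j , S , S∈ = <-≤-trans (c-positive S j) (≤-trans
        (≤-sum (∈-map⁺ (λ T → c T j) (∈-filter⁺ (_∈? on j) (∈-allFin S) S∈)))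
        (lookup (xs≤max 0 (map load (allFin m))) (∈-map⁺ load (∈-allFin j))))
      where
      ≤-sum : ∀ {x xs} → x List.∈ xs → x ≤ sum xs
      ≤-sum {xs = y ∷ ys} (here refl) = m≤m+n y (sum ys)
      ≤-sum {xs = y ∷ ys} (there x∈)  = ≤-trans (≤-sum x∈) (m≤n+m (sum ys) y)

    Δ : Subset n → ℚ
    Δ R = _/_ (+ weight (cov R)) length {{>-nonZero length-positive}}

open Scheduling public using (Sequences; Feasible; Optimal; cost; Assignment)

-- An assignment uses at least one set, so a call needs S′ nonempty.
PDSAlgorithm : Set
PDSAlgorithm = (I : Instance) → let open Instance I in
  (R : Subset n) (S′ : Subset k) → .(Nonempty S′) → Assignment I S′

IsPDSApproximation : ℝ → PDSAlgorithm → Set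
IsPDSApproximation α A =
  ∀ I → let open Instance I; open Scheduling.Assignment in
  (R : Subset n) (S′ : Subset k) (S′≠∅ : Nonempty S′) (F : Assignment I S′) →
  Δ F R ≤ α · Δ (A I R S′ S′≠∅) R

module Greedy (A : PDSAlgorithm) (I : Instance) where
  open Instance I
  open Scheduling.Assignment

  record State : Set where
    constructor state
    field
      π  : Sequences I
      R  : Subset n
      S′ : Subset k

  initial : State
  initial = state (λ _ → []) ⊤ ⊤

  -- One iteration of the loop; `appended j` lists the sets newly assigned to j
  -- in an arbitrary order.
  data Step : State → State → Set where
    iterate : ∀ {π R S′} → Nonempty R → (S′≠∅ : Nonempty S′) →
      let F = A I R S′ S′≠∅ in
      (appended : Sequences I) → (∀ j → appended j ↭ elements (on F j)) →
      Step (state π R S′)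
           (state (λ j → π j ++ appended j) (R ─ cov F R) (S′ ─ assigned F))

  -- Every execution from s reaches R = ∅ after finitely many iterations,
  -- whatever orders are chosen, and never has to call A with no sets left.
  data Terminates (s : State) : Set where
    stop : Empty (State.R s) → Terminates s
    next : ∃ (Step s) → (∀ {s′} → Step s s′ → Terminates s′) → Terminates s

  Returns : Sequences I → Set
  Returns π = ∃[ R ] ∃[ S′ ] Star Step initial (state π R S′) × Empty R

{-# OPTIONS --safe #-}
module Submission where

-- Let r, x and ℓ be the weight of R, the weight newly covered and the length of
-- the assignment in an iteration of GREEDY, so that the greedy schedule costs at
-- most the sum of all rℓ.  Let W(t) be the weight that σ leaves uncovered at time
-- t, so that the W(t) sum to cost(σ).  Restricting σ to the sets it finishes by
-- time t competes in the density problem, hence rℓ ≤ W(t)ℓ + αxt.  For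
-- t < rℓ/(2αx) this gives r ≤ 2W(t).  In the histogram with columns
-- min(r, 2W(t)) the drop from r to r − x therefore removes at least x from each of
-- these columns, which pays for rℓ at the rate 2α, and the histogram has area at
-- most 2 cost(σ).  With α replaced by a rational a/b above it, and denominators
-- cleared, all of this takes place in ℕ.

open import Defs
open import Data.Bool using (true; false; if_then_else_)
open import Data.Fin as Fin using (Fin)
open import Data.Fin.Properties using (any?)
open import Data.Fin.Subset
  using (Subset; inside; outside; _∈_; _∉_; _∩_; _─_; ⊤; ⁅_⁆; ⋃; Nonempty; Empty; ∣_∣)
open import Data.Fin.Subset.Properties
  using (_∈?_; nonempty?; ∈⊤; ∉⊥; x∈p∩q⁺; x∈p∩q⁻; x∈p∪q⁺; x∈p∪q⁻; p─q⊆p;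
         x∈p∧x∉q⇒x∈p─q; p∩q≢∅⇒∣p─q∣<∣p∣; x∈⁅x⁆; x∈⁅y⁆⇒x≡y)
import Data.Integer as ℤ
import Data.Integer.Properties as ℤ
open import Data.List using (List; []; _∷_; _++_; map; concatMap; filter; foldr; allFin)
open import Data.List.Extrema.Nat using (xs≤max; max≤v⁺)
import Data.List.Membership.Propositional as List
open import Data.List.Membership.Propositional.Properties
  using (∈-allFin; ∈-filter⁺; ∈-filter⁻; ∈-map⁺; ∈-map⁻; ∈-++⁺ˡ; ∈-++⁺ʳ; ∈-++⁻;
         ∈-∃++; ∈-concat⁺′; ∈-concat⁻′; foldr-selective)
open import Data.List.Properties using (map-++; ++-assoc; ++-identityʳ)
open import Data.List.Relation.Binary.Permutation.Propositional using (_↭_; ↭-refl; ↭-sym; ↭⇒↭ₛ)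
open import Data.List.Relation.Binary.Permutation.Propositional.Properties
  using (∈-resp-↭; map⁺; shift)
import Data.List.Relation.Binary.Permutation.Setoid.Properties as ↭ₛ
import Data.List.Relation.Unary.All as All
import Data.List.Relation.Unary.All.Properties as All
open import Data.List.Relation.Unary.AllPairs using ([]; _∷_)
open import Data.List.Relation.Unary.Any using (here; there)
open import Data.List.Relation.Unary.Unique.Propositional using (Unique)
import Data.List.Relation.Unary.Unique.Propositional.Properties as Unique
open import Data.Nat
open import Data.Nat.Induction using (Acc; acc; <-wellFounded)
open import Data.Nat.ListAction using (sum)
open import Data.Nat.ListAction.Properties using (sum-++; sum-↭)
open import Data.Nat.Properties
open import Data.Nat.Tactic.RingSolver using (solve-∀)
open import Data.Product using (∃-syntax; _×_; _,_; proj₁; proj₂)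
open import Data.Rational as ℚ using (ℚ; 1ℚ; ↥_; ↧ₙ_)
import Data.Rational.Properties as ℚ
open import Data.Rational.Unnormalised as ℚᵘ using (mkℚᵘ)
import Data.Rational.Unnormalised.Properties as ℚᵘ
open import Data.Sum as Sum using (_⊎_; inj₁; inj₂; [_,_]′)
open import Data.Vec using (_∷_; here; there)
open import Function using (_∘_; it)
open import Function.Bundles using (Equivalence; _⇔_; mk⇔)
open import Level using (0ℓ)
open import Relation.Binary.Construct.Closure.ReflexiveTransitive using (Star; ε; _◅_)
open import Relation.Binary.PropositionalEquality
open import Relation.Nullary using (¬_; does; yes; no; contradiction)
open import Relation.Unary using (Pred; Decidable)

-- Sums over lists

module _ {A : Set} where

  sum-map-mono : ∀ {f g : A → ℕ} xs → (∀ {x} → x List.∈ xs → f x ≤ g x) →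
                 sum (map f xs) ≤ sum (map g xs)
  sum-map-mono []       f≤g = z≤n
  sum-map-mono (x ∷ xs) f≤g = +-mono-≤ (f≤g (here refl)) (sum-map-mono xs (f≤g ∘ there))

  sum-map-* : ∀ (f : A → ℕ) k xs → sum (map (λ x → f x * k) xs) ≡ sum (map f xs) * k
  sum-map-* f k []       = refl
  sum-map-* f k (x ∷ xs) =
    trans (cong₂ _+_ refl (sum-map-* f k xs)) (sym (*-distribʳ-+ k (f x) _))

  term≤sum : ∀ (f : A → ℕ) {x xs} → x List.∈ xs → f x ≤ sum (map f xs)
  term≤sum f (here refl) = m≤m+n _ _
  term≤sum f (there x∈)  = ≤-trans (term≤sum f x∈) (m≤n+m _ _)

  sum-++-map : ∀ (f : A → ℕ) xs ys → sum (map f (xs ++ ys)) ≡ sum (map f xs) + sum (map f ys)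
  sum-++-map f xs ys = trans (cong sum (map-++ f xs ys)) (sum-++ (map f xs) (map f ys))

  -- Each head of `xs` is moved to the front of `ys` by a permutation and then deleted; uniqueness
  -- of `xs` ensures that the tail survives the deletion. With `ys = []` this shows that sums
  -- vanish.
  sum-⊆ : ∀ (f : A → ℕ) {xs ys} → Unique xs → (∀ {x} → x List.∈ xs → x List.∈ ys) →
          sum (map f xs) ≤ sum (map f ys)
  sum-⊆ f []            _     = z≤n
  sum-⊆ f {x ∷ xs} (x∉ ∷ uniq) xs⊆ with ∈-∃++ (xs⊆ (here refl))
  ... | ys , zs , refl = ≤-trans
    (+-monoʳ-≤ (f x) (sum-⊆ f uniq xs⊆′))
    (≤-reflexive (sym (sum-↭ (map⁺ f (shift x ys zs)))))
    where
    xs⊆′ : ∀ {z} → z List.∈ xs → z List.∈ ys ++ zs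
    xs⊆′ z∈ with ∈-resp-↭ (shift x ys zs) (xs⊆ (there z∈))
    ... | here refl = contradiction refl (All.lookup x∉ z∈)
    ... | there z∈′ = z∈′

  sum-map-+ : ∀ (f g : A → ℕ) xs →
    sum (map (λ x → f x + g x) xs) ≡ sum (map f xs) + sum (map g xs)
  sum-map-+ f g []       = refl
  sum-map-+ f g (x ∷ xs) = trans (cong (λ s → f x + g x + s) (sum-map-+ f g xs))
    (interchange (f x) (g x) (sum (map f xs)) (sum (map g xs)))
    where
    interchange : ∀ a b c d → a + b + (c + d) ≡ a + c + (b + d)
    interchange = solve-∀

  infixl 8 _when_

  -- Extension by zero: it turns sums over different filters of one list into sums over the list
  -- itself, which can be compared pointwise.
  _when_ : (A → ℕ) → {P : Pred A 0ℓ} → Decidable P → A → ℕ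
  (f when P?) x = if does (P? x) then f x else 0

  when-elim : ∀ (B : ℕ → Set) (f : A → ℕ) {P : Pred A 0ℓ} (P? : Decidable P) x →
              (P x → B (f x)) → (¬ P x → B 0) → B ((f when P?) x)
  when-elim B f P? x B⁺ B⁻ with P? x
  ... | yes p = B⁺ p
  ... | no ¬p = B⁻ ¬p

  sum-filter : ∀ (f : A → ℕ) {P : Pred A 0ℓ} (P? : Decidable P) xs →
               sum (map f (filter P? xs)) ≡ sum (map (f when P?) xs)
  sum-filter f P? []       = refl
  sum-filter f P? (x ∷ xs) with does (P? x)
  ... | true  = cong (f x +_) (sum-filter f P? xs)
  ... | false = sum-filter f P? xs

  module _ {P Q V : Pred A 0ℓ} (P? : Decidable P) (Q? : Decidable Q) (V? : Decidable V)
           (f : A → ℕ) (xs : List A) where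

    private
      sum-filters : sum (map f (filter Q? xs)) + sum (map f (filter V? xs)) ≡
                    sum (map (λ x → (f when Q?) x + (f when V?) x) xs)
      sum-filters = trans (cong₂ _+_ (sum-filter f Q? xs) (sum-filter f V? xs))
        (sym (sum-map-+ (f when Q?) (f when V?) xs))

    sum-filter-⊎ : (∀ {x} → P x → Q x ⊎ V x) →
      sum (map f (filter P? xs)) ≤ sum (map f (filter Q? xs)) + sum (map f (filter V? xs))
    sum-filter-⊎ P⇒ rewrite sum-filters | sum-filter f P? xs =
      sum-map-mono xs λ {x} _ → pointwise x
      where
      pointwise : ∀ x → (f when P?) x ≤ (f when Q?) x + (f when V?) x
      pointwise x with P? x | Q? x | V? x
      ... | no  _ | _     | _     = z≤n
      ... | yes _ | yes _ | _     = m≤m+n _ _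
      ... | yes _ | no  _ | yes _ = ≤-refl
      ... | yes p | no ¬q | no ¬v = contradiction (P⇒ p) [ ¬q , ¬v ]′

    sum-filter-disjoint : (∀ {x} → Q x → P x) → (∀ {x} → V x → P x) → (∀ {x} → Q x → ¬ V x) →
      sum (map f (filter Q? xs)) + sum (map f (filter V? xs)) ≤ sum (map f (filter P? xs))
    sum-filter-disjoint Q⇒ V⇒ Q⊥V rewrite sum-filters | sum-filter f P? xs =
      sum-map-mono xs λ {x} _ → pointwise x
      where
      pointwise : ∀ x → (f when Q?) x + (f when V?) x ≤ (f when P?) x
      pointwise x with P? x | Q? x | V? x
      ... | _     | yes q | yes v = contradiction v (Q⊥V q)
      ... | _     | no  _ | no  _ = z≤n
      ... | no ¬p | yes q | no  _ = contradiction (Q⇒ q) ¬p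
      ... | no ¬p | no  _ | yes v = contradiction (V⇒ v) ¬p
      ... | yes _ | no  _ | yes _ = ≤-refl
      ... | yes _ | yes _ | no  _ = ≤-reflexive (+-identityʳ (f x))

-- Sums over discrete time

Σ< : ℕ → (ℕ → ℕ) → ℕ
Σ< zero    g = 0
Σ< (suc N) g = Σ< N g + g N

Σ<-mono : ∀ N {g h : ℕ → ℕ} → (∀ t → g t ≤ h t) → Σ< N g ≤ Σ< N h
Σ<-mono zero    g≤h = z≤n
Σ<-mono (suc N) g≤h = +-mono-≤ (Σ<-mono N g≤h) (g≤h N)

Σ<-* : ∀ N k (g : ℕ → ℕ) → Σ< N (λ t → k * g t) ≡ k * Σ< N g
Σ<-* zero    k g = sym (*-zeroʳ k)
Σ<-* (suc N) k g = trans (cong₂ _+_ (Σ<-* N k g) refl) (sym (*-distribˡ-+ k (Σ< N g) (g N)))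

-- Induction on `N`: while `c < N` the last column is merely compared; once `c = N` every remaining
-- column gains `x`, so `c` and `N` decrease together. The product `x * c` is the area of the strip
-- gained.
Σ<-raise : ∀ N c x {g h : ℕ → ℕ} → c ≤ N → (∀ t → g t ≤ h t) → (∀ {t} → t < c → x + g t ≤ h t) →
           x * c + Σ< N g ≤ Σ< N h
Σ<-raise N       zero    x     c≤N g≤h raise rewrite *-zeroʳ x = Σ<-mono N g≤h
Σ<-raise (suc N) (suc c) x {g} c≤N g≤h raise with m≤n⇒m<n∨m≡n c≤N
... | inj₁ (s≤s c≤N′) = ≤-trans (≤-reflexive (sym (+-assoc (x * suc c) (Σ< N g) (g N))))
  (+-mono-≤ (Σ<-raise N (suc c) x c≤N′ g≤h raise) (g≤h N))
... | inj₂ refl = ≤-trans (≤-reflexive (regroup x c (Σ< c g) (g c)))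
  (+-mono-≤ (Σ<-raise c c x ≤-refl g≤h (raise ∘ m<n⇒m<1+n)) (raise ≤-refl))
  where
  regroup : ∀ x c s e → x * suc c + (s + e) ≡ (x * c + s) + (x + e)
  regroup = solve-∀

-- Layer-cake summation: `x` lies in the layers `t = 0, ..., τ x - 1`, hence its weight is counted
-- at most `τ x` times.
Σ<-layers : ∀ {A : Set} (w τ : A → ℕ) xs N →
  Σ< N (λ t → sum (map w (filter (λ x → t <? τ x) xs))) ≤ sum (map (λ x → w x * τ x) xs)
Σ<-layers w τ xs N = ≤-trans (truncated N)
  (sum-map-mono xs λ {x} _ → *-monoʳ-≤ (w x) (m⊓n≤m (τ x) N))
  where
  layer : ℕ → ℕ
  layer t = sum (map w (filter (λ x → t <? τ x) xs))

  -- Capping `τ` at `N` makes the claim inductive: layer `N` contributes `w x` exactly when the cap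
  -- of `x` still grows.
  truncated : ∀ N → Σ< N layer ≤ sum (map (λ x → w x * (τ x ⊓ N)) xs)
  truncated zero    = z≤n
  truncated (suc N) = begin
    Σ< N layer + layer N
      ≤⟨ +-mono-≤ (truncated N) (≤-reflexive (sum-filter w (λ x → N <? τ x) xs)) ⟩
    sum (map (λ x → w x * (τ x ⊓ N)) xs) + sum (map (w when (λ x → N <? τ x)) xs)
      ≡⟨ sum-map-+ _ _ xs ⟨
    sum (map (λ x → w x * (τ x ⊓ N) + (w when (λ x → N <? τ x)) x) xs)
      ≤⟨ sum-map-mono xs (λ {x} _ → pointwise x) ⟩
    sum (map (λ x → w x * (τ x ⊓ suc N)) xs) ∎
    where
    open ≤-Reasoning
    pointwise : ∀ x → w x * (τ x ⊓ N) + (w when (λ x → N <? τ x)) x ≤ w x * (τ x ⊓ suc N)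
    pointwise x = when-elim (λ v → w x * (τ x ⊓ N) + v ≤ w x * (τ x ⊓ suc N)) w (λ x → N <? τ x) x
      grow (λ _ → ≤-trans (≤-reflexive (+-identityʳ _)) (*-monoʳ-≤ (w x) (⊓-monoʳ-≤ (τ x) (n≤1+n N))))
      where
      grow : N < τ x → w x * (τ x ⊓ N) + w x ≤ w x * (τ x ⊓ suc N)
      grow N<τ rewrite m≥n⇒m⊓n≡n (<⇒≤ N<τ) | m≥n⇒m⊓n≡n N<τ =
        ≤-reflexive (trans (+-comm _ (w x)) (sym (*-suc (w x) N)))

-- Arithmetic of one iteration

-- Searching down from `N` finds the least `c` with `B ≤ f * c`, that is, the ceiling of `B / f`
-- without a division and without a separate case for `f = 0`.
threshold : ∀ N f B → B ≤ f * N → ∃[ c ] c ≤ N × B ≤ f * c × (∀ {t} → t < c → f * t < B)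
threshold zero    f B B≤ = 0 , z≤n , B≤ , λ ()
threshold (suc N) f B B≤ with B ≤? f * N
... | yes B≤′ with c , c≤ , B≤c , below ← threshold N f B B≤′ = c , m≤n⇒m≤1+n c≤ , B≤c , below
... | no  B≰  = suc N , ≤-refl , B≤ , λ t<c → ≤-<-trans (*-monoʳ-≤ f (s≤s⁻¹ t<c)) (≰⇒> B≰)

-- `C`, `C′` and `CX` stand for the final cost of the elements in R, of those that remain and of
-- those newly covered. The term `b * (r * L)` accounts for the elapsed time; advancing it by `ℓ`
-- adds `b * ℓ * r`, and the strip `x * h` lost by the area pays for this at rate `2 * a`.
amortise-step : ∀ a b r r′ x L ℓ h {C C′ CX s s′} → C ≤ C′ + CX → CX ≤ x * (L + ℓ) →
  b * C′ ≤ b * (r′ * (L + ℓ)) + 2 * a * s′ → r′ + x ≤ r →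
  b * ℓ * r ≤ 2 * (a * x) * h → x * h + s′ ≤ s → b * C ≤ b * (r * L) + 2 * a * s
amortise-step a b r r′ x L ℓ h {C} {C′} {CX} {s} {s′} C≤ CX≤ C′≤ r′+x≤r charged s′≤s = begin
  b * C
    ≤⟨ *-monoʳ-≤ b C≤ ⟩
  b * (C′ + CX)
    ≡⟨ *-distribˡ-+ b C′ CX ⟩
  b * C′ + b * CX
    ≤⟨ +-mono-≤ C′≤ (*-monoʳ-≤ b CX≤) ⟩
  b * (r′ * (L + ℓ)) + 2 * a * s′ + b * (x * (L + ℓ))
    ≡⟨ collect b r′ x (L + ℓ) (2 * a * s′) ⟩
  b * ((r′ + x) * (L + ℓ)) + 2 * a * s′
    ≤⟨ +-monoˡ-≤ (2 * a * s′) (*-monoʳ-≤ b (*-monoˡ-≤ (L + ℓ) r′+x≤r)) ⟩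
  b * (r * (L + ℓ)) + 2 * a * s′
    ≡⟨ spread b r L ℓ (2 * a * s′) ⟩
  b * (r * L) + (b * ℓ * r + 2 * a * s′)
    ≤⟨ +-monoʳ-≤ (b * (r * L)) (+-monoˡ-≤ (2 * a * s′) charged) ⟩
  b * (r * L) + (2 * (a * x) * h + 2 * a * s′)
    ≡⟨ cong (b * (r * L) +_) (factor a x h s′) ⟩
  b * (r * L) + 2 * a * (x * h + s′)
    ≤⟨ +-monoʳ-≤ (b * (r * L)) (*-monoʳ-≤ (2 * a) s′≤s) ⟩
  b * (r * L) + 2 * a * s ∎
  where
  open ≤-Reasoning
  collect : ∀ b r x t s → b * (r * t) + s + b * (x * t) ≡ b * ((r + x) * t) + s
  collect = solve-∀
  spread : ∀ b r L ℓ s → b * (r * (L + ℓ)) + s ≡ b * (r * L) + (b * ℓ * r + s)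
  spread = solve-∀
  factor : ∀ a x h s → 2 * (a * x) * h + 2 * a * s ≡ 2 * a * (x * h + s)
  factor = solve-∀

-- Clearing denominators

toℚᵘ-/ : ∀ x l → ℚ.toℚᵘ (ℤ.+ x ℚ./ suc l) ℚᵘ.≃ mkℚᵘ (ℤ.+ x) l
toℚᵘ-/ x l = ℚ.toℚᵘ-fromℚᵘ (mkℚᵘ (ℤ.+ x) l)

-- Since `_/_` reduces fractions, the comparison passes to unnormalised rationals, where the order
-- is cross-multiplication of the given numerators and denominators.
fraction-≤ : ∀ q {a} → ↥ q ≡ ℤ.+ a → ∀ x l y l′ .{{_ : NonZero l}} .{{_ : NonZero l′}} →
             (ℤ.+ x ℚ./ l) ℚ.≤ q ℚ.* (ℤ.+ y ℚ./ l′) ⇔ x * (↧ₙ q * l′) ≤ a * y * l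
fraction-≤ q@(ℚ.mkℚ (ℤ.+ a) b _) refl x (suc l) y (suc l′) = mk⇔ to from
  where
  numerators : ℤ.+ (a * y) ℤ.* ℤ.+ suc l ≡ ℤ.+ (a * y * suc l)
  numerators = sym (ℤ.pos-* (a * y) (suc l))

  rhs : ℚ.toℚᵘ (q ℚ.* (ℤ.+ y ℚ./ suc l′)) ℚᵘ.≃ mkℚᵘ (ℤ.+ a) b ℚᵘ.* mkℚᵘ (ℤ.+ y) l′
  rhs = ℚᵘ.≃-trans (ℚ.toℚᵘ-homo-* q (ℤ.+ y ℚ./ suc l′))
    (ℚᵘ.*-congˡ {ℚ.toℚᵘ q} {ℚ.toℚᵘ (ℤ.+ y ℚ./ suc l′)} {mkℚᵘ (ℤ.+ y) l′} (toℚᵘ-/ y l′))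

  to : _ → _
  to le with ℚᵘ.≤-respʳ-≃ rhs (ℚᵘ.≤-respˡ-≃ (toℚᵘ-/ x l) (ℚ.toℚᵘ-mono-≤ le))
  ... | ℚᵘ.*≤* le′ = ℤ.drop‿+≤+ (subst₂ ℤ._≤_ (sym (ℤ.pos-* x _))
    (trans (cong (ℤ._* ℤ.+ suc l) (sym (ℤ.pos-* a y))) numerators) le′)

  from : _ → _
  from le = ℚ.toℚᵘ-cancel-≤ (ℚᵘ.≤-respʳ-≃ (ℚᵘ.≃-sym rhs) (ℚᵘ.≤-respˡ-≃ (ℚᵘ.≃-sym (toℚᵘ-/ x l))
    (ℚᵘ.*≤* (subst₂ ℤ._≤_ (ℤ.pos-* x _)
      (sym (trans (cong (ℤ._* ℤ.+ suc l) (sym (ℤ.pos-* a y))) numerators)) (ℤ.+≤+ le)))))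

fromℕ-≤ : ∀ q {a} → ↥ q ≡ ℤ.+ a → ∀ x y → ↧ₙ q * x ≤ a * y → fromℕ x ℚ.≤ q ℚ.* fromℕ y
fromℕ-≤ q {a} ↥q≡a x y le = Equivalence.from (fraction-≤ q ↥q≡a x 1 y 1) (begin
  x * (↧ₙ q * 1)  ≡⟨ cong (x *_) (*-identityʳ (↧ₙ q)) ⟩
  x * ↧ₙ q        ≡⟨ *-comm x (↧ₙ q) ⟩
  ↧ₙ q * x        ≤⟨ le ⟩
  a * y           ≡⟨ *-identityʳ (a * y) ⟨
  a * y * 1       ∎)
  where open ≤-Reasoning

-- Subsets, lists and minima

x∈p─q⇒x∉q : ∀ {n x} (p q : Subset n) → x ∈ p ─ q → x ∉ q
x∈p─q⇒x∉q (_ ∷ p) (inside  ∷ q) (there x∈) (there x∈q) = x∈p─q⇒x∉q p q x∈ x∈q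
x∈p─q⇒x∉q (_ ∷ p) (outside ∷ q) (there x∈) (there x∈q) = x∈p─q⇒x∉q p q x∈ x∈q

∈-⋃⁺ : ∀ {n x} {p : Subset n} {ps} → p List.∈ ps → x ∈ p → x ∈ ⋃ ps
∈-⋃⁺ (here refl) x∈ = x∈p∪q⁺ (inj₁ x∈)
∈-⋃⁺ (there p∈)  x∈ = x∈p∪q⁺ (inj₂ (∈-⋃⁺ p∈ x∈))

∈-⋃⁻ : ∀ {n x} (ps : List (Subset n)) → x ∈ ⋃ ps → ∃[ p ] p List.∈ ps × x ∈ p
∈-⋃⁻ []       x∈ = contradiction x∈ ∉⊥
∈-⋃⁻ (p ∷ ps) x∈ with x∈p∪q⁻ p (⋃ ps) x∈
... | inj₁ x∈p = p , here refl , x∈p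
... | inj₂ x∈ps with r , r∈ , x∈r ← ∈-⋃⁻ ps x∈ps = r , there r∈ , x∈r

∈-elements⁺ : ∀ {n x} {p : Subset n} → x ∈ p → x List.∈ elements p
∈-elements⁺ {x = x} {p} = ∈-filter⁺ (_∈? p) (∈-allFin x)

∈-elements⁻ : ∀ {n x} (p : Subset n) → x List.∈ elements p → x ∈ p
∈-elements⁻ {n} p = proj₂ ∘ ∈-filter⁻ (_∈? p) {xs = allFin n}

elements-unique : ∀ {n} (p : Subset n) → Unique (elements p)
elements-unique {n} p = Unique.filter⁺ (_∈? p) (Unique.allFin⁺ n)

∈-concatMap : ∀ {A B : Set} {f : A → List B} {x y xs} → x List.∈ xs → y List.∈ f x →
              y List.∈ concatMap f xs
∈-concatMap {f = f} x∈ y∈ = ∈-concat⁺′ y∈ (∈-map⁺ f x∈)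

∈-concatMap⁻ : ∀ {A B : Set} (f : A → List B) xs {y} → y List.∈ concatMap f xs →
               ∃[ x ] x List.∈ xs × y List.∈ f x
∈-concatMap⁻ f xs y∈ with ∈-concat⁻′ (map f xs) y∈
... | _ , y∈′ , ys∈ with ∈-map⁻ f ys∈
... | x , x∈ , refl = x , x∈ , y∈′

minimum-≤ : ∀ {x xs} → x List.∈ xs → minimum xs ≤ x
minimum-≤ {x} {y ∷ xs} x∈ = go xs x∈
  where
  go : ∀ xs → x List.∈ y ∷ xs → foldr _⊓_ y xs ≤ x
  go []       (here refl)         = ≤-refl
  go (z ∷ xs) (here refl)         = ≤-trans (m⊓n≤n z _) (go xs (here refl))
  go (z ∷ xs) (there (here refl)) = m⊓n≤m z _
  go (z ∷ xs) (there (there x∈))  = ≤-trans (m⊓n≤n z _) (go xs (there x∈))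

-- The membership hypothesis excludes the empty list, on which `minimum` has the default value 0.
minimum-∈ : ∀ {x xs} → x List.∈ xs → minimum xs List.∈ xs
minimum-∈ {xs = y ∷ xs} _ with foldr-selective ⊓-sel y xs
... | inj₁ ≡y = here ≡y
... | inj₂ ∈xs = there ∈xs

Unique-resp-↭ : ∀ {A : Set} {xs ys : List A} → xs ↭ ys → Unique xs → Unique ys
Unique-resp-↭ {A} xs↭ys = ↭ₛ.Unique-resp-↭ (setoid A) (↭⇒↭ₛ xs↭ys)

fromList : ∀ {n} → List (Fin n) → Subset n
fromList = ⋃ ∘ map ⁅_⁆

∈-fromList⁺ : ∀ {n} {x : Fin n} {xs} → x List.∈ xs → x ∈ fromList xs
∈-fromList⁺ {x = x} x∈ = ∈-⋃⁺ (∈-map⁺ ⁅_⁆ x∈) (x∈⁅x⁆ x)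

∈-fromList⁻ : ∀ {n} {x : Fin n} xs → x ∈ fromList xs → x List.∈ xs
∈-fromList⁻ xs x∈ with ∈-⋃⁻ (map ⁅_⁆ xs) x∈
... | _ , p∈ , x∈p with ∈-map⁻ ⁅_⁆ p∈
... | y , y∈ , refl with refl ← x∈⁅y⁆⇒x≡y y x∈p = y∈

-- The longest prefix of total at most `t`, computed with the remaining budget as argument. For the
-- costs on one machine it consists of the sets finished by time `t`.
finishedBy : ∀ {A : Set} → (A → ℕ) → ℕ → List A → List A
finishedBy f t []       = []
finishedBy f t (x ∷ xs) with f x ≤? t
... | yes _ = x ∷ finishedBy f (t ∸ f x) xs
... | no  _ = []

finishedBy-⊆ : ∀ {A : Set} (f : A → ℕ) t xs {x} → x List.∈ finishedBy f t xs → x List.∈ xs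
finishedBy-⊆ f t (y ∷ xs) x∈ with f y ≤? t
finishedBy-⊆ f t (y ∷ xs) (here refl) | yes _ = here refl
finishedBy-⊆ f t (y ∷ xs) (there x∈)  | yes _ = there (finishedBy-⊆ f (t ∸ f y) xs x∈)

finishedBy-sum : ∀ {A : Set} (f : A → ℕ) t xs → sum (map f (finishedBy f t xs)) ≤ t
finishedBy-sum f t []       = z≤n
finishedBy-sum f t (x ∷ xs) with f x ≤? t
... | yes fx≤t = ≤-trans (+-monoʳ-≤ (f x) (finishedBy-sum f (t ∸ f x) xs))
                         (≤-reflexive (m+[n∸m]≡n fx≤t))
... | no  _    = z≤n

-- Finish times, assignments and uncovered weight

module _ (I : Instance) where
  open Instance I
  open Scheduling I hiding (Sequences; Feasible; Optimal; cost; Assignment)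
  open Scheduling.Assignment hiding (one-machine)

  -- The prefix stops at the first occurrence of `S`, which lies in `l`. Hence sets appended later
  -- never delay a set already scheduled.
  prefix-++ : ∀ (f : Fin k → ℕ) {S} l r → S List.∈ l →
              sum (map f (prefix S (l ++ r))) ≤ sum (map f l)
  prefix-++ f {S} (T ∷ l) r S∈ with S Fin.≟ T
  ... | yes _ = +-monoʳ-≤ (f T) z≤n
  prefix-++ f {S} (T ∷ l) r (here S≡T) | no S≢T = contradiction S≡T S≢T
  prefix-++ f {S} (T ∷ l) r (there S∈) | no _   = +-monoʳ-≤ (f T) (prefix-++ f l r S∈)

  prefix⇒finishedBy : ∀ (f : Fin k → ℕ) t l {S} → S List.∈ l → sum (map f (prefix S l)) ≤ t →
                      S List.∈ finishedBy f t l
  prefix⇒finishedBy f t (T ∷ l) {S} S∈ sum≤ with S Fin.≟ T | f T ≤? t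
  ... | yes refl | yes _   = here refl
  ... | yes refl | no fT≰t = contradiction (≤-trans (m≤m+n (f T) 0) sum≤) fT≰t
  ... | no _     | no fT≰t = contradiction (≤-trans (m≤m+n (f T) _) sum≤) fT≰t
  prefix⇒finishedBy f t (T ∷ l) (here S≡T) sum≤ | no S≢T | yes _ = contradiction S≡T S≢T
  prefix⇒finishedBy f t (T ∷ l) (there S∈) sum≤ | no _ | yes _ =
    there (prefix⇒finishedBy f (t ∸ f T) l S∈ (m+n≤o⇒m≤o∸n _ (subst (_≤ t) (+-comm (f T) _) sum≤)))

  ct-≤ : ∀ (π : Sequences I) {u S} j → S List.∈ π j → u ∈ 𝒮 S → ct π u ≤ ft π j S
  ct-≤ π {u} j S∈ u∈ = minimum-≤
    (∈-concatMap (∈-allFin j) (∈-map⁺ (ft π j) (∈-filter⁺ (λ S → u ∈? 𝒮 S) S∈ u∈)))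

  -- Coverage makes the list of finish times nonempty, so its minimum is a genuine finish time and
  -- not the default value.
  ct-attained : ∀ {π} → Covers π → ∀ u →
                ∃[ j ] ∃[ S ] S List.∈ π j × u ∈ 𝒮 S × ct π u ≡ ft π j S
  ct-attained {π} covers u with covers u
  ... | j , S , S∈ , u∈ with ∈-concatMap⁻ (λ j → map (ft π j) (filter (λ S → u ∈? 𝒮 S) (π j)))
    (allFin m) (minimum-∈ (∈-concatMap (∈-allFin j)
      (∈-map⁺ (ft π j) (∈-filter⁺ (λ S → u ∈? 𝒮 S) S∈ u∈))))
  ... | i , _ , ct∈ with ∈-map⁻ (ft π i) ct∈
  ... | T , T∈ , ct≡ with ∈-filter⁻ (λ S → u ∈? 𝒮 S) T∈
  ... | T∈π , u∈T = i , T , T∈π , u∈T , ct≡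

  module _ {S′ : Subset k} (F : Assignment I S′) where

    ∈-assigned⁺ : ∀ {S} j → S ∈ on F j → S ∈ assigned F
    ∈-assigned⁺ j S∈ = ∈-⋃⁺ (∈-map⁺ (on F) (∈-allFin j)) S∈

    ∈-cov⁺ : ∀ {R u S} j → S ∈ on F j → u ∈ 𝒮 S → u ∈ R → u ∈ cov F R
    ∈-cov⁺ {R} j S∈ u∈S u∈R = ∈-⋃⁺
      (∈-concatMap (∈-allFin j) (∈-map⁺ (λ S → 𝒮 S ∩ R) (∈-elements⁺ S∈))) (x∈p∩q⁺ (u∈S , u∈R))

    ∈-cov⁻ : ∀ R {u} → u ∈ cov F R → u ∈ R × ∃[ j ] ∃[ S ] S ∈ on F j × u ∈ 𝒮 S
    ∈-cov⁻ R u∈ with ∈-⋃⁻ _ u∈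
    ... | _ , p∈ , u∈p
      with ∈-concatMap⁻ (λ j → map (λ S → 𝒮 S ∩ R) (elements (on F j))) (allFin m) p∈
    ... | j , _ , p∈j with ∈-map⁻ (λ S → 𝒮 S ∩ R) p∈j
    ... | S , S∈ , refl with x∈p∩q⁻ (𝒮 S) R u∈p
    ... | u∈S , u∈R = u∈R , j , S , ∈-elements⁻ (on F j) S∈ , u∈S

    load≤length : ∀ j → load F j ≤ length F
    load≤length j = All.lookup (xs≤max 0 (map (load F) (allFin m))) (∈-map⁺ (load F) (∈-allFin j))

  uncovered : Sequences I → ℕ → ℕ
  uncovered σ t = sum (map w (filter (λ u → t <? ct σ u) (allFin n)))

  module _ {σ : Sequences I} (sched : IsSchedule σ) (covers : Covers σ)
           {R : Subset n} {S′ : Subset k} (useful : ∀ {u S} → u ∈ R → u ∈ 𝒮 S → S ∈ S′) where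

    private
      -- The schedule `σ` may use sets outside `S′`, which an assignment from `S′` cannot contain.
      -- By `useful` those sets miss `R`, so the intersection loses no coverage of `R`.
      finished : ℕ → Fin m → Subset k
      finished t j = fromList (finishedBy (λ T → c T j) t (σ j)) ∩ S′

      finished⁻ : ∀ t j {S} → S ∈ finished t j → S List.∈ finishedBy (λ T → c T j) t (σ j) × S ∈ S′
      finished⁻ t j S∈ with x∈p∩q⁻ (fromList (finishedBy (λ T → c T j) t (σ j))) S′ S∈
      ... | S∈l , S∈S′ = ∈-fromList⁻ _ S∈l , S∈S′

      finished⁺ : ∀ t {u} → u ∈ R → ct σ u ≤ t → ∃[ j ] ∃[ S ] S ∈ finished t j × u ∈ 𝒮 S
      finished⁺ t {u} u∈R ct≤t =
        let j , S , S∈σ , u∈S , ct≡ft = ct-attained covers u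
            S∈l = prefix⇒finishedBy (λ T → c T j) t (σ j) S∈σ (≤-trans (≤-reflexive (sym ct≡ft)) ct≤t)
        in j , S , x∈p∩q⁺ (∈-fromList⁺ S∈l , useful u∈R u∈S) , u∈S

      truncate : ∀ t → ∃[ j ] Nonempty (finished t j) → Assignment I S′
      truncate t nonempty = record
        { on          = finished t
        ; available   = λ j → proj₂ ∘ finished⁻ t j
        ; one-machine = λ {i} {j} S∈i S∈j → IsSchedule.one-machine sched
            (finishedBy-⊆ _ t (σ i) (proj₁ (finished⁻ t i S∈i)))
            (finishedBy-⊆ _ t (σ j) (proj₁ (finished⁻ t j S∈j)))
        ; nonempty    = nonempty
        }

      length-truncate : ∀ t ne → length (truncate t ne) ≤ t
      length-truncate t ne = max≤v⁺ z≤n (All.map⁺ (All.universal load≤t (allFin m)))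
        where
        load≤t : ∀ j → load (truncate t ne) j ≤ t
        load≤t j = ≤-trans
          (sum-⊆ (λ T → c T j) (elements-unique (finished t j))
            (proj₁ ∘ finished⁻ t j ∘ ∈-elements⁻ (finished t j)))
          (finishedBy-sum (λ T → c T j) t (σ j))

    -- The sets that σ finishes by time t form an assignment of length at most t.
    uncovered-bound : ∀ {p d} → (∀ F → p * weight (cov {I} {S′} F R) ≤ d * length F) →
                      ∀ t → p * weight R ≤ p * uncovered σ t + d * t
    uncovered-bound {p} {d} dense t with any? (λ j → nonempty? (finished t j))
    -- An assignment must be nonempty, so none arises here; but then all of `R` is still uncovered
    -- at time `t`, and the first summand alone suffices.
    ... | no none = ≤-trans (*-monoʳ-≤ p (sum-⊆ w (elements-unique R) late)) (m≤m+n _ _)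
      where
      late : ∀ {u} → u List.∈ elements R → u List.∈ filter (λ u → t <? ct σ u) (allFin n)
      late {u} u∈ = ∈-filter⁺ (λ u → t <? ct σ u) (∈-allFin u) (≰⇒> λ ct≤t →
        let j , S , S∈ , _ = finished⁺ t (∈-elements⁻ R u∈) ct≤t in none (j , S , S∈))
    ... | yes ne = begin
      p * weight R
        ≤⟨ *-monoʳ-≤ p (sum-filter-⊎ (_∈? R) (λ u → t <? ct σ u) (_∈? cov F R) w (allFin n) split) ⟩
      p * (uncovered σ t + weight (cov F R))      ≡⟨ *-distribˡ-+ p _ _ ⟩
      p * uncovered σ t + p * weight (cov F R)    ≤⟨ +-monoʳ-≤ _ (dense F) ⟩
      p * uncovered σ t + d * length F
        ≤⟨ +-monoʳ-≤ (p * uncovered σ t) (*-monoʳ-≤ d (length-truncate t ne)) ⟩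
      p * uncovered σ t + d * t                   ∎
      where
      open ≤-Reasoning
      F : Assignment I S′
      F = truncate t ne
      split : ∀ {u} → u ∈ R → t < ct σ u ⊎ u ∈ cov F R
      split {u} u∈R = Sum.map₂ (λ ct≤t →
        let j , S , S∈ , u∈S = finished⁺ t u∈R ct≤t in ∈-cov⁺ F j S∈ u∈S u∈R) (<-≤-connex t (ct σ u))

  -- Weights are at least 1. The cost of `σ` can therefore serve as a time horizon at which nothing
  -- is left uncovered.
  ct≤cost : ∀ σ u → ct σ u ≤ cost I σ
  ct≤cost σ u = ≤-trans (m≤n*m (ct σ u) (w u) {{>-nonZero (w-positive u)}})
    (term≤sum (λ u → w u * ct σ u) (∈-allFin u))

  uncovered-cost : ∀ σ → uncovered σ (cost I σ) ≡ 0
  uncovered-cost σ = n≤0⇒n≡0 (sum-⊆ w {ys = []}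
    (Unique.filter⁺ (λ u → cost I σ <? ct σ u) (Unique.allFin⁺ n))
    λ {u} u∈ → contradiction (proj₂ (∈-filter⁻ (λ u → cost I σ <? ct σ u) {xs = allFin n} u∈)) (≤⇒≯ (ct≤cost σ u)))

  weighted : Sequences I → Subset n → ℕ
  weighted π R = sum (map (λ u → w u * ct π u) (elements R))

  module _ {π : Sequences I} {X : Subset n} {t : ℕ} where

    weighted-≤ : (∀ {u} → u ∈ X → ct π u ≤ t) → weighted π X ≤ weight X * t
    weighted-≤ ct≤t = ≤-trans
      (sum-map-mono (elements X) λ {u} u∈ → *-monoʳ-≤ (w u) (ct≤t (∈-elements⁻ X u∈)))
      (≤-reflexive (sum-map-* w t (elements X)))

  machineLoad : Sequences I → Fin m → ℕ
  machineLoad π j = sum (map (λ S → c S j) (π j))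

-- Executions of GREEDY: invariant and termination

module _ (A : PDSAlgorithm) {I : Instance} where
  open Instance I
  open Scheduling I hiding (Sequences; Feasible; Optimal; cost; Assignment)
  open Scheduling.Assignment hiding (one-machine)
  open Greedy A I

  -- The field `useful` serves twice: it supplies a set for the next call while `R` is nonempty, and
  -- it lets the sets of a competing schedule be restricted to `S′`.
  record Invariant (s : State) : Set where
    open State s
    field
      useful     : ∀ {u S} → u ∈ R → u ∈ 𝒮 S → S ∈ S′
      covered    : ∀ {u} → u ∉ R → ∃[ j ] ∃[ S ] S List.∈ π j × u ∈ 𝒮 S
      isSchedule : IsSchedule π
      fresh      : ∀ {S} j → S List.∈ π j → S ∉ S′

  open Invariant

  invariant-initial : Invariant initial
  invariant-initial = record
    { useful     = λ _ _ → ∈⊤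
    ; covered    = λ u∉⊤ → contradiction ∈⊤ u∉⊤
    ; isSchedule = record { once-per-machine = λ _ → [] ; one-machine = λ () }
    ; fresh      = λ _ ()
    }

  -- For `useful`, a set taken by the assignment has all its elements of `R` covered, so it cannot
  -- meet what is left of `R`. Since `π` uses no set of `S′`, the new sets do not collide with the
  -- old ones.
  invariant-step : ∀ {s s′} → Step s s′ → Invariant s → Invariant s′
  invariant-step (iterate {π} {R} {S′} R≠∅ S′≠∅ appended perm) inv = record
    { useful     = useful′
    ; covered    = covered′
    ; isSchedule = record { once-per-machine = once ; one-machine = λ {i} {j} → one i j }
    ; fresh      = fresh′
    }
    where
    F : Assignment I S′
    F = A I R S′ S′≠∅

    on-F : ∀ j {S} → S List.∈ appended j → S ∈ on F j
    on-F j S∈ = ∈-elements⁻ (on F j) (∈-resp-↭ (perm j) S∈)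

    useful′ : ∀ {u S} → u ∈ R ─ cov F R → u ∈ 𝒮 S → S ∈ S′ ─ assigned F
    useful′ {u} {S} u∈ u∈S = x∈p∧x∉q⇒x∈p─q (useful inv u∈R u∈S) S∉
      where
      u∈R : u ∈ R
      u∈R = p─q⊆p R (cov F R) u∈
      S∉ : S ∉ assigned F
      S∉ S∈ with ∈-⋃⁻ (map (on F) (allFin m)) S∈
      ... | _ , p∈ , S∈p with ∈-map⁻ (on F) p∈
      ... | j , _ , refl = x∈p─q⇒x∉q R (cov F R) u∈ (∈-cov⁺ I F j S∈p u∈S u∈R)

    covered′ : ∀ {u} → u ∉ R ─ cov F R → ∃[ j ] ∃[ S ] S List.∈ π j ++ appended j × u ∈ 𝒮 S
    covered′ {u} u∉ with u ∈? cov F R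
    ... | no u∉cov with covered inv (λ u∈R → u∉ (x∈p∧x∉q⇒x∈p─q u∈R u∉cov))
    ...   | j , S , S∈ , u∈S = j , S , ∈-++⁺ˡ S∈ , u∈S
    covered′ {u} u∉ | yes u∈cov with ∈-cov⁻ I F R u∈cov
    ...   | _ , j , S , S∈ , u∈S =
      j , S , ∈-++⁺ʳ (π j) (∈-resp-↭ (↭-sym (perm j)) (∈-elements⁺ S∈)) , u∈S

    clash : ∀ {S} i j → S List.∈ π i → ¬ S List.∈ appended j
    clash i j S∈π S∈a = fresh inv i S∈π (available F j (on-F j S∈a))

    once : ∀ j → Unique (π j ++ appended j)
    once j = Unique.++⁺ (IsSchedule.once-per-machine (isSchedule inv) j)
      (Unique-resp-↭ (↭-sym (perm j)) (elements-unique (on F j)))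
      λ (S∈π , S∈a) → clash j j S∈π S∈a

    one : ∀ i j {S} → S List.∈ π i ++ appended i → S List.∈ π j ++ appended j → i ≡ j
    one i j S∈i S∈j with ∈-++⁻ (π i) S∈i | ∈-++⁻ (π j) S∈j
    ... | inj₁ ∈i | inj₁ ∈j = IsSchedule.one-machine (isSchedule inv) ∈i ∈j
    ... | inj₁ ∈i | inj₂ ∈j = contradiction ∈j (clash i j ∈i)
    ... | inj₂ ∈i | inj₁ ∈j = contradiction ∈i (clash j i ∈j)
    ... | inj₂ ∈i | inj₂ ∈j = Scheduling.Assignment.one-machine F (on-F i ∈i) (on-F j ∈j)

    fresh′ : ∀ {S} j → S List.∈ π j ++ appended j → S ∉ S′ ─ assigned F
    fresh′ j S∈ S∈─ with ∈-++⁻ (π j) S∈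
    ... | inj₁ ∈π = fresh inv j ∈π (p─q⊆p S′ (assigned F) S∈─)
    ... | inj₂ ∈a = x∈p─q⇒x∉q S′ (assigned F) S∈─ (∈-assigned⁺ I F j (on-F j ∈a))

  -- An assignment uses at least one set, even if it covers nothing of `R`; the number of remaining
  -- sets is therefore the termination measure.
  step-shrinks : ∀ {s s′} → Step s s′ → ∣ State.S′ s′ ∣ < ∣ State.S′ s ∣
  step-shrinks (iterate {S′ = S′} _ S′≠∅ _ _) = p∩q≢∅⇒∣p─q∣<∣p∣ S′ (assigned F) shared
    where
    F : Assignment I S′
    F = A I _ S′ S′≠∅
    shared : Nonempty (S′ ∩ assigned F)
    shared with nonempty F
    ... | j , S , S∈ = S , x∈p∩q⁺ (available F j S∈ , ∈-assigned⁺ I F j S∈)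

  terminates : ∀ s → Acc _<_ ∣ State.S′ s ∣ → Invariant s → Terminates s
  terminates s@(state π R S′) (acc rec) inv with nonempty? R
  ... | no  R≡∅            = stop λ where (u , u∈) → R≡∅ (u , u∈)
  -- An element `u` of `R` lies in some set, which `useful` shows to be still available, so the
  -- algorithm can be called.
  ... | yes R≠∅@(u , u∈R) with 𝒮-covers u
  ...   | S , u∈S = next
    (_ , iterate R≠∅ (S , useful inv u∈R u∈S) _ (λ _ → ↭-refl))
    (λ step → terminates _ (rec (step-shrinks step)) (invariant-step step inv))

  invariant-star : ∀ {s s′} → Star Step s s′ → Invariant s → Invariant s′
  invariant-star ε              inv = inv
  invariant-star (step ◅ steps) inv = invariant-star steps (invariant-step step inv)

  extends : ∀ {s s′} → Star Step s s′ → ∀ j → ∃[ l ] State.π s′ j ≡ State.π s j ++ l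
  extends ε j = [] , sym (++-identityʳ _)
  extends (iterate {π} _ _ appended _ ◅ steps) j with extends steps j
  ... | l , eq = appended j ++ l , trans eq (++-assoc (π j) (appended j) l)

  -- The amortised cost bound

  module _ {σ : Sequences I} (feasible : Feasible I σ) (a b : ℕ) .{{_ : NonZero b}}
    (approx : ∀ R S′ (S′≠∅ : Nonempty S′) (F : Assignment I S′) →
      weight (cov F R) * (b * length (A I R S′ S′≠∅)) ≤
      a * weight (cov (A I R S′ S′≠∅) R) * length F) where

    private
      W : ℕ → ℕ
      W = uncovered I σ

      N : ℕ
      N = cost I σ

      area : ℕ → ℕ
      area r = Σ< N (λ t → r ⊓ (2 * W t))

    -- Here `h` is the least time with `p * r ≤ 2 * d * h`. Before it `d * t` stays below half of
    -- `p * r`, so `bound` leaves at least the other half to `p * W t`.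
    charge : ∀ p d {r} .{{_ : NonZero p}} → (∀ t → p * r ≤ p * W t + d * t) →
      ∃[ h ] h ≤ N × p * r ≤ 2 * d * h × (∀ {t} → t < h → r ≤ 2 * W t)
    charge p d {r} bound with threshold N (2 * d) (p * r) atN
      where
      open ≤-Reasoning
      -- At the horizon `W N = 0`, so `bound N` yields even `p * r ≤ d * N`; this gives `h ≤ N`.
      atN : p * r ≤ 2 * d * N
      atN = begin
        p * r            ≤⟨ bound N ⟩
        p * W N + d * N  ≡⟨ cong (λ v → p * v + d * N) (uncovered-cost I σ) ⟩
        p * 0 + d * N    ≡⟨ cong (_+ d * N) (*-zeroʳ p) ⟩
        d * N            ≤⟨ *-monoˡ-≤ N (m≤m+n d (1 * d)) ⟩
        2 * d * N        ∎
    ... | h , h≤N , pr≤ , below = h , h≤N , pr≤ , λ {t} t<h →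
      -- The bound is doubled instead of halving `p * r`; one copy of `p * r` then cancels.
      *-cancelˡ-≤ p (+-cancelʳ-≤ (p * r) (p * r) (p * (2 * W t)) (begin
        p * r + p * r                              ≤⟨ +-mono-≤ (bound t) (bound t) ⟩
        (p * W t + d * t) + (p * W t + d * t)      ≡⟨ double p (W t) d t ⟩
        p * (2 * W t) + 2 * d * t                  ≤⟨ +-monoʳ-≤ (p * (2 * W t)) (<⇒≤ (below t<h)) ⟩
        p * (2 * W t) + p * r                      ∎))
      where
      open ≤-Reasoning
      double : ∀ p v d t → (p * v + d * t) + (p * v + d * t) ≡ p * (2 * v) + 2 * d * t
      double = solve-∀

    -- L bounds the time elapsed at s; the second summand bounds the cost of waiting after L.
    amortised : ∀ {s f} → Star Step s f → Empty (State.R f) → Invariant s →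
      ∀ {L} → (∀ j → machineLoad I (State.π s) j ≤ L) →
      b * weighted I (State.π f) (State.R s) ≤
      b * (weight (State.R s) * L) + 2 * a * area (weight (State.R s))
    amortised {s} ε R≡∅ inv = λ _ →
      ≤-trans (≤-reflexive (trans (cong (b *_) nothing) (*-zeroʳ b))) z≤n
      where
      nothing : weighted I (State.π s) (State.R s) ≡ 0
      nothing = n≤0⇒n≡0 (sum-⊆ _ {ys = []} (elements-unique (State.R s))
        λ {u} u∈ → contradiction (u , ∈-elements⁻ (State.R s) u∈) R≡∅)
    amortised {f = f} (step@(iterate {π} {R} {S′} R≠∅ S′≠∅ appended perm) ◅ steps) R≡∅ inv {L} load≤L =
      conclude charged
      where
      F : Assignment I S′
      F = A I R S′ S′≠∅
      πf : Sequences I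
      πf = State.π f
      X R′ : Subset n
      X  = cov F R
      R′ = R ─ X
      x ℓ : ℕ
      x = weight X
      ℓ = length F

      dense : ∀ G → b * ℓ * weight (cov {I} {S′} G R) ≤ a * x * length G
      dense G = ≤-trans (≤-reflexive (*-comm (b * ℓ) _)) (approx R S′ S′≠∅ G)

      charged : ∃[ h ] h ≤ N × b * ℓ * weight R ≤ 2 * (a * x) * h ×
                       (∀ {t} → t < h → weight R ≤ 2 * W t)
      -- Dividing by `b * ℓ` is legitimate because every assignment has positive length.
      charged = charge (b * ℓ) (a * x) {{m*n≢0 b ℓ {{it}} {{>-nonZero (length-positive F)}}}}
        (uncovered-bound I (proj₁ feasible) (proj₂ feasible) (useful inv) {b * ℓ} {a * x} dense)

      split : ∀ {u} → u ∈ R → u ∈ R′ ⊎ u ∈ X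
      split {u} u∈R with u ∈? X
      ... | yes u∈X = inj₂ u∈X
      ... | no  u∉X = inj₁ (x∈p∧x∉q⇒x∈p─q u∈R u∉X)

      R′+X : weight R′ + x ≤ weight R
      R′+X = sum-filter-disjoint (_∈? R) (_∈? R′) (_∈? X) w (allFin n)
        (p─q⊆p R X) (proj₁ ∘ ∈-cov⁻ I F R) (x∈p─q⇒x∉q R X)

      load≤L+ℓ : ∀ j → machineLoad I (λ j → π j ++ appended j) j ≤ L + ℓ
      load≤L+ℓ j = ≤-trans (≤-reflexive (sum-++-map (λ S → c S j) (π j) (appended j)))
        (+-mono-≤ (load≤L j)
          (≤-trans (≤-reflexive (sum-↭ (map⁺ (λ S → c S j) (perm j)))) (load≤length I F j)))

      -- A set covering `u` is on its machine by the end of this iteration, when every load is at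
      -- most `L + ℓ`; later iterations only append behind it.
      ct-X : ∀ {u} → u ∈ X → ct πf u ≤ L + ℓ
      ct-X {u} u∈X with ∈-cov⁻ I F R u∈X | extends steps
      ... | _ , j , S , S∈F , u∈S | ext = ≤-trans (ct-≤ I πf j S∈πf u∈S) (≤-trans ft≤ (load≤L+ℓ j))
        where
        l : List (Fin k)
        l = proj₁ (ext j)
        S∈ : S List.∈ π j ++ appended j
        S∈ = ∈-++⁺ʳ (π j) (∈-resp-↭ (↭-sym (perm j)) (∈-elements⁺ S∈F))
        S∈πf : S List.∈ πf j
        S∈πf = subst (S List.∈_) (sym (proj₂ (ext j))) (∈-++⁺ˡ S∈)
        ft≤ : ft πf j S ≤ machineLoad I (λ j → π j ++ appended j) j
        ft≤ = subst (λ l → sum (map (λ T → c T j) (prefix S l)) ≤ _) (sym (proj₂ (ext j)))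
          (prefix-++ I (λ T → c T j) (π j ++ appended j) l S∈)

      shrink : ∀ t → weight R′ ⊓ (2 * W t) ≤ weight R ⊓ (2 * W t)
      shrink t = ⊓-monoˡ-≤ (2 * W t) (≤-trans (m≤m+n (weight R′) x) R′+X)

      -- The column of `R` has its full height `weight R` here, so removing `X` lowers it by at
      -- least `x`.
      raise : ∀ {t} → weight R ≤ 2 * W t → x + (weight R′ ⊓ (2 * W t)) ≤ weight R ⊓ (2 * W t)
      raise {t} R≤2W = ≤-trans (+-monoʳ-≤ x (m⊓n≤m (weight R′) (2 * W t)))
        (≤-trans (≤-reflexive (+-comm x (weight R′)))
          (≤-trans R′+X (≤-reflexive (sym (m≤n⇒m⊓n≡m R≤2W)))))

      conclude : ∃[ h ] h ≤ N × b * ℓ * weight R ≤ 2 * (a * x) * h ×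
                        (∀ {t} → t < h → weight R ≤ 2 * W t) →
                 b * weighted I πf R ≤ b * (weight R * L) + 2 * a * area (weight R)
      conclude (h , h≤N , pr≤ , below) = amortise-step a b (weight R) (weight R′) x L ℓ h
        (sum-filter-⊎ (_∈? R) (_∈? R′) (_∈? X) (λ u → w u * ct πf u) (allFin n) split)
        (weighted-≤ I {πf} {X} {L + ℓ} ct-X)
        (amortised steps R≡∅ (invariant-step step inv) load≤L+ℓ)
        R′+X pr≤ (Σ<-raise N h x h≤N shrink (raise ∘ below))

    approximation : ∀ {π} → Returns π → b * cost I π ≤ a * (4 * cost I σ)
    approximation {π} (R , S′ , steps , R≡∅) = begin
      b * cost I π
        ≤⟨ *-monoʳ-≤ b (sum-⊆ _ (Unique.allFin⁺ n) (λ _ → ∈-elements⁺ ∈⊤)) ⟩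
      b * weighted I π ⊤
        -- All machines start empty, so `L = 0` and the term for elapsed time vanishes.
        ≤⟨ amortised steps R≡∅ invariant-initial (λ _ → z≤n) ⟩
      b * (weight ⊤ * 0) + 2 * a * area (weight ⊤)
        ≡⟨ cong (_+ 2 * a * area (weight ⊤)) (trans (cong (b *_) (*-zeroʳ (weight ⊤))) (*-zeroʳ b)) ⟩
      2 * a * area (weight ⊤)
        -- The columns are at most `2 * W t`; this 2 and the charging rate `2 * a` make up the
        -- factor `4 * a`.
        ≤⟨ *-monoʳ-≤ (2 * a) (Σ<-mono N (λ t → m⊓n≤n (weight ⊤) (2 * W t))) ⟩
      2 * a * Σ< N (λ t → 2 * W t)
        ≡⟨ cong (2 * a *_) (Σ<-* N 2 W) ⟩
      2 * a * (2 * Σ< N W)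
        ≤⟨ *-monoʳ-≤ (2 * a) (*-monoʳ-≤ 2 (Σ<-layers w (ct σ) (allFin n) N)) ⟩
      2 * a * (2 * cost I σ)
        ≡⟨ quadruple a (cost I σ) ⟩
      a * (4 * cost I σ) ∎
      where
      open ≤-Reasoning
      quadruple : ∀ a v → 2 * a * (2 * v) ≡ a * (4 * v)
      quadruple = solve-∀

  returns-feasible : ∀ {π} → Returns π → Feasible I π
  returns-feasible (R , S′ , steps , R≡∅) =
    isSchedule inv , λ u → covered inv (λ u∈R → R≡∅ (u , u∈R))
    where
    inv : Invariant (state _ R S′)
    inv = invariant-star steps invariant-initial

-- Passage to the real ratio

-- A negative upper bound of α would put 1 in the upper cut.
upper-nonneg : ∀ {α q} → 1ℚ ≤ᴿ α → ℝ.upper α q → ∃[ a ] ↥ q ≡ ℤ.+ a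
upper-nonneg {q = ℚ.mkℚ (ℤ.+ a) _ _}          _   _  = a , refl
upper-nonneg {α} {q@(ℚ.mkℚ ℤ.-[1+ _ ] _ _)} 1≤α α<q = contradiction
  (Equivalence.from (ℝ.upper-rounded α 1ℚ) (q , ℚ.<-trans (ℚ.negative⁻¹ q) (ℚ.positive⁻¹ 1ℚ) , α<q))
  1≤α

theorem3p1 : (α : ℝ) → 1ℚ ≤ᴿ α →
    (A : PDSAlgorithm) → IsPDSApproximation α A →
    (I : Instance) →
    Greedy.Terminates A I (Greedy.initial A I) ×
    (∀ π → Greedy.Returns A I π →
    Feasible I π ×
    (∀ σ → Optimal I σ → fromℕ (cost I π) ≤ α · fromℕ (4 * cost I σ)))
theorem3p1 α 1≤α A approx I =
  terminates A _ (<-wellFounded _) (invariant-initial A) ,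
  λ π returns → returns-feasible A returns ,
    λ σ (feasible , _) q α<q →
    bound returns feasible q α<q (upper-nonneg {α} 1≤α α<q)
  where
  open Scheduling I using (weight)
  open Scheduling.Assignment using (cov; length; length-positive)

  -- The guarantee for `A` is read at the same rational `q` above `α` at which the conclusion is to
  -- be shown.
  cleared : ∀ q {a} → ↥ q ≡ ℤ.+ a → ℝ.upper α q →
    ∀ R S′ (S′≠∅ : Nonempty S′) (F : Assignment I S′) →
    weight (cov F R) * (↧ₙ q * length (A I R S′ S′≠∅)) ≤
    a * weight (cov (A I R S′ S′≠∅) R) * length F
  cleared q ↥q≡a α<q R S′ S′≠∅ F = Equivalence.to
    (fraction-≤ q ↥q≡a (weight (cov F R)) (length F)
      (weight (cov (A I R S′ S′≠∅) R)) (length (A I R S′ S′≠∅))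
      {{>-nonZero (length-positive F)}} {{>-nonZero (length-positive (A I R S′ S′≠∅))}})
    (approx I R S′ S′≠∅ F q α<q)

  bound : ∀ {π σ} → Greedy.Returns A I π → Feasible I σ → ∀ q → ℝ.upper α q →
          ∃[ a ] ↥ q ≡ ℤ.+ a → fromℕ (cost I π) ℚ.≤ q ℚ.* fromℕ (4 * cost I σ)
  bound {π} {σ} returns feasible q α<q (a , ↥q≡a) = fromℕ-≤ q ↥q≡a (cost I π) (4 * cost I σ)
    (approximation A feasible a (↧ₙ q) (cleared q ↥q≡a α<q) returns)
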